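{- Let $\mathbb F$ be a field and let $d\ge 8$ be an even integer. If the non-uniform algebraic $(\frac d2-1,\frac d2)$-hyperclique conjecture holds over $\mathbb F$, then circuit complexity $\mathrm C$ is not submultiplicative on $d$-mode tensors over $\mathbb F$.
   Context: A $d$-mode tensor over $\mathbb F$ is a polynomial in variables partitioned into $d$ nonempty disjoint sets $X_1,\dots,X_d$ (modes, of arbitrary finite sizes) all of whose monomials contain exactly one variable from each mode, with degree one. The Kronecker product $S\otimes T$ of $d$-mode tensors with modes $X_i$ and $Y_i$ is the polynomial product $ST$, viewed as a $d$-mode tensor with modes $X_i\times Y_i$ (a product $xy$ with $x\in X_i$, $y\in Y_i$ is regarded as one variable). An arithmetic circuit is a directed acyclic graph whose sources (inputs) are labeled by field elements or variables, whose other vertices (gates) are labeled $+$ or $\times$ (with arbitrary fan-in), and whose edges (wires) are labeled by field elements by which the transmitted value is multiplied; its size is the number of wires. $\mathrm C(T)$ is the minimum size of an arithmetic circuit over $\mathbb F$ computing $T$. $\mathrm C$ is submultiplicative on $d$-mode tensors if $\mathrm C(T\otimes U)\le\mathrm C(T)\cdot\mathrm C(U)$ for all $d$-mode tensors $T,U$. For integers $3\le h<k$ and $N\in\mathbb N$, let $H^N_{h,k}$ be the tensor with $\binom kh$ modes $X^{(S)}=\{x^{(S)}_g : g\colon S\to[N]\}$, $S\in\binom{[k]}{h}$ (the $h$-element subsets of $[k]$), defined by $$H^N_{h,k}=\sum_{f\colon[k]\to[N]}\ \prod_{S\in\binom{[k]}{h}} x^{(S)}_{f|_S}.$$ The non-uniform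 algebraic $(h,k)$-hyperclique conjecture states that for no $\varepsilon>0$ is there a family $(C_N)_{N\in\mathbb N}$ of arithmetic circuits over $\mathbb F$, with $C_N$ computing $H^N_{h,k}$, of size $O(N^{k-\varepsilon})$. -}

module Defs where

open import Level using (Level; _⊔_) renaming (suc to lsuc)
open import Algebra.Apartness.Bundles using (HeytingField)
open import Data.Fin.Base using (Fin)
open import Data.Fin.Subset using (Subset; inside; outside; ∣_∣)
import Data.Integer.Base as ℤ
open import Data.List.Base
  using (List; []; _∷_; [_]; map; _++_; foldr; allFin; cartesianProductWith)
open import Data.List.NonEmpty.Base as List⁺ using (List⁺)
open import Data.Nat.Base using (ℕ; zero; suc; _+_; _*_; _^_; _≤_)
open import Data.Nat.Properties using (≤-reflexive; ≤-trans; *-mono-≤)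
open import Data.Product.Base using (Σ-syntax; ∃; ∃-syntax; _×_; _,_; proj₁)
open import Data.Rational.Base as ℚ using (ℚ; 0ℚ; ↥_; ↧ₙ_)
open import Data.Vec.Base as Vec using (Vec; []; _∷_)
open import Function.Bundles using (_↔_; _⇔_; mk⇔)
open import Relation.Binary.PropositionalEquality.Core using (_≡_; refl; cong)
open import Relation.Nullary.Negation.Core using (¬_)

-- Functions on [k], and on S ⊆ [k], are vectors rather than Agda functions,
-- so that restrictions agreeing pointwise are propositionally equal and
-- index the same variable.  A function on S lists its values in increasing
-- order of the elements of S.

functions : (k N : ℕ) → List (Vec (Fin N) k)
functions zero    N = [ [] ]
functions (suc k) N = cartesianProductWith _∷_ (allFin N) (functions k N)

restrict : ∀ {a} {A : Set a} {k} (S : Subset k) → Vec A k → Vec A ∣ S ∣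
restrict []            []      = []
restrict (inside  ∷ S) (a ∷ f) = a ∷ restrict S f
restrict (outside ∷ S) (a ∷ f) = restrict S f

SubsetOfSize : (h k : ℕ) → Set
SubsetOfSize h k = Σ[ S ∈ Subset k ] ∣ S ∣ ≡ h

-- Every h-element subset of [k], exactly once.
subsetsOfSize : ∀ h k → List (SubsetOfSize h k)
subsetsOfSize zero    zero    = [ [] , refl ]
subsetsOfSize (suc h) zero    = []
subsetsOfSize zero    (suc k) =
  map (λ (S , e) → outside ∷ S , e) (subsetsOfSize zero k)
subsetsOfSize (suc h) (suc k) =
  map (λ (S , e) → inside  ∷ S , cong suc e) (subsetsOfSize h k) ++
  map (λ (S , e) → outside ∷ S , e) (subsetsOfSize (suc h) k)

-- The variables x^{(S)}_g with g : S → [N].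
HVar : (h k N : ℕ) → Set
HVar h k N = Σ[ (S , _) ∈ SubsetOfSize h k ] Vec (Fin N) ∣ S ∣

FiniteNonempty : Set → Set
FiniteNonempty A = ∃[ n ] A ↔ Fin (suc n)

-- The dependent pair makes the modes disjoint.
Var : ∀ {d} → (Fin d → Set) → Set
Var {d} X = Σ[ i ∈ Fin d ] X i

_⊠_ : ∀ {d} → (Fin d → Set) → (Fin d → Set) → Fin d → Set
(X ⊠ Y) i = X i × Y i

-- The class O(N^{k-ε}).  With ε = p/q in lowest terms, s ≤ C · N^{k-p/q}
-- is rewritten as s^q · N^p ≤ C^q · N^{kq}, which also covers ε > k.
IsO[N^_-_] : ℕ → ℚ → (ℕ → ℕ) → Set
IsO[N^ k - ε ] s = ∃[ c ] ∃[ N₀ ] ∀ N → N₀ ≤ N →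
  s N ^ (↧ₙ ε) * N ^ ℤ.∣ ↥ ε ∣ ≤ c * N ^ (k * ↧ₙ ε)

-- Classically a Heyting field is exactly a field, with x # y meaning ¬ (x ≈ y).
module Over {c ℓ₁ ℓ₂ : Level} (F : HeytingField c ℓ₁ ℓ₂) where

  private module F = HeytingField F

  infixl 6 _⊕_
  infixl 7 _⊛_
  infix  4 _≋_

  -- The polynomial ring F[V], presented as the free commutative F-algebra
  -- on V: expressions modulo _≋_.  Negation is multiplication by con (- 1).
  data Poly (V : Set) : Set c where
    con : F.Carrier → Poly V
    var : V → Poly V
    _⊕_ : Poly V → Poly V → Poly V
    _⊛_ : Poly V → Poly V → Poly V

  data _≋_ {V : Set} : Poly V → Poly V → Set (c ⊔ ℓ₁) where
    ≋-refl      : ∀ {p} → p ≋ p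
    ≋-sym       : ∀ {p q} → p ≋ q → q ≋ p
    ≋-trans     : ∀ {p q r} → p ≋ q → q ≋ r → p ≋ r
    ⊕-cong      : ∀ {p p′ q q′} → p ≋ p′ → q ≋ q′ → p ⊕ q ≋ p′ ⊕ q′
    ⊛-cong      : ∀ {p p′ q q′} → p ≋ p′ → q ≋ q′ → p ⊛ q ≋ p′ ⊛ q′
    ⊕-assoc     : ∀ p q r → (p ⊕ q) ⊕ r ≋ p ⊕ (q ⊕ r)
    ⊕-comm      : ∀ p q → p ⊕ q ≋ q ⊕ p
    ⊕-identityˡ : ∀ p → con F.0# ⊕ p ≋ p
    ⊛-assoc     : ∀ p q r → (p ⊛ q) ⊛ r ≋ p ⊛ (q ⊛ r)
    ⊛-comm      : ∀ p q → p ⊛ q ≋ q ⊛ p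
    ⊛-identityˡ : ∀ p → con F.1# ⊛ p ≋ p
    ⊛-distribˡ  : ∀ p q r → p ⊛ (q ⊕ r) ≋ (p ⊛ q) ⊕ (p ⊛ r)
    ⊛-zeroˡ     : ∀ p → con F.0# ⊛ p ≋ con F.0#
    con-cong    : ∀ {a b} → a F.≈ b → con a ≋ con b
    con-+       : ∀ a b → con (a F.+ b) ≋ con a ⊕ con b
    con-*       : ∀ a b → con (a F.* b) ≋ con a ⊛ con b

  ∑ ∏ : ∀ {a} {A : Set a} {V : Set} → List A → (A → Poly V) → Poly V
  ∑ as f = foldr (λ a p → f a ⊕ p) (con F.0#) as
  ∏ as f = foldr (λ a p → f a ⊛ p) (con F.1#) as

  -- A tensor is given by its terms: (a , x) is a · ∏ᵢ xᵢ, with one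
  -- variable xᵢ from each mode.  Terms may repeat; tensors are only ever
  -- compared through the polynomials they denote.
  Tensor : ∀ {d} → (Fin d → Set) → Set c
  Tensor X = List (F.Carrier × (∀ i → X i))

  poly : ∀ {d} {X : Fin d → Set} → Tensor X → Poly (Var X)
  poly {d} T = ∑ T λ (a , x) → con a ⊛ ∏ (allFin d) λ i → var (i , x i)

  _⊗_ : ∀ {d} {X Y : Fin d → Set} → Tensor X → Tensor Y → Tensor (X ⊠ Y)
  _⊗_ = cartesianProductWith λ (a , x) (b , y) → a F.* b , λ i → x i , y i

  H : (h k N : ℕ) → Poly (HVar h k N)
  H h k N = ∑ (functions k N) λ f → ∏ (subsetsOfSize h k) λ S →
    var (S , restrict (proj₁ S) f)

  data Op : Set where
    plus times : Op

  Wire : ℕ → Set c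
  Wire n = F.Carrier × Fin n

  data Vertex (V : Set) (n : ℕ) : Set c where
    const : F.Carrier → Vertex V n
    input : V → Vertex V n
    gate  : Op → List⁺ (Wire n) → Vertex V n

  -- Directed acyclic graphs with n vertices in topological order: the wires
  -- into a vertex come from earlier vertices, index zero being the latest.
  -- Vertices may be joined by parallel wires.
  data Dag (V : Set) : ℕ → Set c where
    []  : Dag V zero
    _▷_ : ∀ {n} → Dag V n → Vertex V n → Dag V (suc n)

  wires : ∀ {V n} → Vertex V n → ℕ
  wires (const _)   = 0
  wires (input _)   = 0
  wires (gate _ ws) = List⁺.length ws

  dagSize : ∀ {V n} → Dag V n → ℕ
  dagSize []      = 0
  dagSize (D ▷ v) = dagSize D + wires v

  vertexValue : ∀ {V n} → Vertex V n → Vec (Poly V) n → Poly V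
  vertexValue (const a)       vals = con a
  vertexValue (input x)       vals = var x
  vertexValue (gate plus  ws) vals =
    ∑ (List⁺.toList ws) λ (a , i) → con a ⊛ Vec.lookup vals i
  vertexValue (gate times ws) vals =
    ∏ (List⁺.toList ws) λ (a , i) → con a ⊛ Vec.lookup vals i

  values : ∀ {V n} → Dag V n → Vec (Poly V) n
  values []      = []
  values (D ▷ v) = vertexValue v (values D) ∷ values D

  Circuit : Set → Set c
  Circuit V = ∃ (Dag V)

  size : ∀ {V} → Circuit V → ℕ
  size (_ , D) = dagSize D

  _Computes_ : ∀ {V} → Circuit V → Poly V → Set (c ⊔ ℓ₁)
  (n , D) Computes p = ∃[ i ] Vec.lookup (values D) i ≋ p

  -- The minimum size C(p), as the relation "C(p) = s".
  C[_]≡_ : ∀ {V} → Poly V → ℕ → Set (c ⊔ ℓ₁)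
  C[ p ]≡ s =
    (∃[ Γ ] Γ Computes p × size Γ ≡ s) × (∀ Γ → Γ Computes p → s ≤ size Γ)

  -- "C(p) ≤ s".  A minimum over circuits cannot be computed constructively,
  -- so inequalities between complexities are stated through upper bounds.
  C[_]≤_ : ∀ {V} → Poly V → ℕ → Set (c ⊔ ℓ₁)
  C[ p ]≤ s = ∃[ Γ ] Γ Computes p × size Γ ≤ s

  C[_]≤C[_]*C[_] : ∀ {U V W} → Poly W → Poly U → Poly V → Set (c ⊔ ℓ₁)
  C[ r ]≤C[ p ]*C[ q ] = ∀ s t → C[ p ]≤ s → C[ q ]≤ t → C[ r ]≤ (s * t)

  -- Where the minima exist (classically, always), this is the inequality
  -- between them.
  C≤C*C⇔≤ : ∀ {U V W} {r : Poly W} {p : Poly U} {q : Poly V} {l m n} →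
    C[ r ]≡ l → C[ p ]≡ m → C[ q ]≡ n →
    C[ r ]≤C[ p ]*C[ q ] ⇔ l ≤ m * n
  C≤C*C⇔≤ {r = r} {p} {q} {l} {m} {n}
    ((Γ , Γr , Γ≡l) , minr) ((Δ , Δp , Δ≡m) , minp) ((Θ , Θq , Θ≡n) , minq) =
    mk⇔ to from
    where
    to : C[ r ]≤C[ p ]*C[ q ] → l ≤ m * n
    to C≤ with Λ , Λr , Λ≤mn ← C≤ m n (Δ , Δp , ≤-reflexive Δ≡m)
                                      (Θ , Θq , ≤-reflexive Θ≡n) =
      ≤-trans (minr Λ Λr) Λ≤mn

    from : l ≤ m * n → C[ r ]≤C[ p ]*C[ q ]
    from l≤mn s t (Δ′ , Δ′p , Δ′≤s) (Θ′ , Θ′q , Θ′≤t) =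
      Γ , Γr , ≤-trans (≤-reflexive Γ≡l) (≤-trans l≤mn
        (*-mono-≤ (≤-trans (minp Δ′ Δ′p) Δ′≤s) (≤-trans (minq Θ′ Θ′q) Θ′≤t)))

  Submultiplicative : ℕ → Set (lsuc Level.zero ⊔ c ⊔ ℓ₁)
  Submultiplicative d =
    (X Y : Fin d → Set) →
    (∀ i → FiniteNonempty (X i)) → (∀ i → FiniteNonempty (Y i)) →
    (T : Tensor X) (U : Tensor Y) →
    C[ poly (T ⊗ U) ]≤C[ poly T ]*C[ poly U ]

  -- Taking ε rational loses nothing: the bound O(N^{k-ε}) weakens as ε
  -- decreases.
  HypercliqueConjecture : (h k : ℕ) → Set (c ⊔ ℓ₁)
  HypercliqueConjecture h k =
    ¬ (Σ[ ε ∈ ℚ ] 0ℚ ℚ.< ε ×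
       Σ[ Γ ∈ (∀ N → Circuit (HVar h k N)) ]
         (∀ N → Γ N Computes H h k N) × IsO[N^ k - ε ] (λ N → size (Γ N)))

{-# OPTIONS --safe #-}
module Submission where

-- Write d = 2k and h = k − 1.  Give the 2k modes the names e_j and q_m with
-- j , m ∈ [k], and for i ∈ [h] let
--
--   T_i = Σ_{f : [k] → [N]} ∏_j e_{j , f(s_j(i))} · ∏_m q_{m , f(m)},
--
-- where s_j(i) is the i-th element of [k] ∖ {j}.  Sorting the factors by the
-- element of [k] they depend on turns T_i into a product of k sums of N short
-- products, so C(T_i) = O(N), and submultiplicativity would give
-- C(T_1 ⊗ ⋯ ⊗ T_h) = O(N^h).  In that tensor, substitute for a q_m-variable
-- indexed by (a_1 , … , a_h) the constant [a_1 = ⋯ = a_h]: only the terms in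
-- which T_1 , … , T_h use the same f survive, and their e_j-variable is indexed
-- by the restriction of f to [k] ∖ {j}.  This is H^N_{h,k}, so ε = 1 violates
-- the conjecture.

open import Defs
open import Algebra.Apartness.Bundles using (HeytingField)
open import Algebra.Structures.Biased
  using (IsCommutativeMonoidˡ; IsCommutativeSemiringˡ)
open import Algebra.Bundles using (CommutativeMonoid; CommutativeSemiring)
import Algebra.Properties.CommutativeSemigroup as CommutativeSemigroupProperties
open import Data.Bool.Base using (true; false; if_then_else_)
open import Data.Fin.Base using (Fin; zero; suc; _↑ˡ_; _↑ʳ_; splitAt; punchIn)
open import Data.Fin.Properties using (_≟_; suc-injective; splitAt-↑ˡ; splitAt-↑ʳ; 1↔⊤; *↔×)
open import Data.Fin.Subset using (inside; outside)
open import Data.List.Base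
  using (List; []; _∷_; [_]; map; _++_; foldr; allFin; cartesianProductWith; length)
import Data.List.Properties as List
open import Data.List.NonEmpty.Base as List⁺ using (_∷_)
open import Data.Nat.Base
  using (ℕ; zero; suc; _+_; _*_; _^_; _≤_; _<_; _∸_; _/_; z≤n; s≤s)
open import Data.Nat.Divisibility using (_∣_; divides)
open import Data.Nat.DivMod using (m*n/n≡m)
open import Data.Nat.Properties
  using (≤-refl; ≤-reflexive; ≤-trans; module ≤-Reasoning; +-mono-≤; +-monoʳ-≤; *-monoˡ-≤;
         *-monoʳ-≤; m≤n*m; +-assoc; +-identityʳ; *-assoc; *-comm; *-identityˡ; *-identityʳ;
         *-distribˡ-+; n<1+n; +-commutativeSemigroup; m<n⇒m<1+n;
         [m*n]*[o*p]≡[m*o]*[n*p])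
open import Data.Product.Base using (_×_; _,_; proj₁; proj₂; map₂)
open import Data.Product.Function.NonDependent.Propositional using (_×-↔_)
open import Data.Rational.Base using (1ℚ)
open import Data.Rational.Properties using (positive⁻¹)
open import Data.Sum.Base using (_⊎_; inj₁; inj₂; [_,_]′)
open import Data.Unit.Base using (⊤; tt)
open import Data.Vec.Base as Vec using (Vec; []; _∷_; lookup; tabulate)
import Data.Vec.Properties as Vec
open import Function.Base using (_∘_; id)
open import Function.Construct.Composition using (_↔-∘_)
open import Function.Construct.Identity using (↔-id)
open import Function.Construct.Symmetry using (↔-sym)
open import Level using (Level)
open import Relation.Binary.PropositionalEquality
  using (_≡_; _≢_; refl; sym; trans; cong; cong₂; subst; module ≡-Reasoning)
open import Relation.Binary.Structures using (IsEquivalence)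
import Relation.Binary.Reasoning.Setoid as SetoidReasoning
open import Relation.Nullary.Decidable using (does; dec-true; dec-false)
open import Relation.Nullary.Negation.Core using (¬_)

-- Subsets of size h of an (h + 1)-element set

subsetsOfSize-< : ∀ {h k} → k < h → subsetsOfSize h k ≡ []
subsetsOfSize-< {suc h} {zero}  _         = refl
subsetsOfSize-< {suc h} {suc k} (s≤s k<h)
  rewrite subsetsOfSize-< k<h | subsetsOfSize-< (m<n⇒m<1+n k<h) = refl

-- Follows the recursion of `subsetsOfSize`, cardinality proof included, so that it is literally the
-- one entry of `subsetsOfSize k k`; the proof is part of the index of a variable of H.
full : ∀ k → SubsetOfSize k k
full zero    = [] , refl
full (suc k) = inside ∷ proj₁ (full k) , cong suc (proj₂ (full k))

subsetsOfSize-full : ∀ k → subsetsOfSize k k ≡ [ full k ]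
subsetsOfSize-full zero    = refl
subsetsOfSize-full (suc k)
  rewrite subsetsOfSize-full k | subsetsOfSize-< (n<1+n k) = refl

-- The complement of j, again with exactly the cardinality proof that `subsetsOfSize` attaches to
-- it.
omit : ∀ {h} → Fin (suc h) → SubsetOfSize h (suc h)
omit {h}     zero    = outside ∷ proj₁ (full h) , proj₂ (full h)
omit {suc h} (suc j) = inside ∷ proj₁ (omit j) , cong suc (proj₂ (omit j))

restrict-full : ∀ {a} {A : Set a} k (f : Vec A k) →
  restrict (proj₁ (full k)) f ≡ Vec.cast (sym (proj₂ (full k))) f
restrict-full zero    []      = refl
restrict-full (suc k) (a ∷ f) = cong (a ∷_) (restrict-full k f)

-- `punchIn j` enumerates the complement of j in increasing order, the order in which `restrict`
-- lists values. The cast bridges the length ∣S∣ of a restriction and h, which are only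
-- propositionally equal.
restrict-omit : ∀ {a} {A : Set a} {h} (j : Fin (suc h)) (f : Vec A (suc h)) →
  restrict (proj₁ (omit j)) f ≡
  Vec.cast (sym (proj₂ (omit j))) (tabulate λ i → lookup f (punchIn j i))
restrict-omit {h = h} zero (a ∷ f) = trans (restrict-full h f)
  (cong (Vec.cast (sym (proj₂ (full h)))) (sym (Vec.tabulate∘lookup f)))
restrict-omit {h = suc h} (suc j) (a ∷ f) = cong (a ∷_) (restrict-omit j f)

-- Folds over lists in a commutative monoid

module Folds {m ℓ : Level} (M : CommutativeMonoid m ℓ) where

  open CommutativeMonoid M renaming (refl to ≈-refl; sym to ≈-sym; trans to ≈-trans)
  open CommutativeSemigroupProperties commutativeSemigroup using (interchange)
  open SetoidReasoning setoid

  fold : ∀ {a} {A : Set a} → List A → (A → Carrier) → Carrier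
  fold as f = foldr (λ a p → f a ∙ p) ε as

  fold-cong : ∀ {a} {A : Set a} (as : List A) {f g : A → Carrier} →
    (∀ x → f x ≈ g x) → fold as f ≈ fold as g
  fold-cong []       f≈g = ≈-refl
  fold-cong (x ∷ as) f≈g = ∙-cong (f≈g x) (fold-cong as f≈g)

  fold-ε : ∀ {a} {A : Set a} (as : List A) {f : A → Carrier} →
    (∀ x → f x ≈ ε) → fold as f ≈ ε
  fold-ε []       f≈ε = ≈-refl
  fold-ε (x ∷ as) f≈ε = ≈-trans (∙-cong (f≈ε x) (fold-ε as f≈ε)) (identityˡ ε)

  fold-map : ∀ {a b} {A : Set a} {B : Set b} (h : A → B) (as : List A)
    (f : B → Carrier) → fold (map h as) f ≈ fold as (f ∘ h)
  fold-map h as f = reflexive (List.foldr-map (λ b p → f b ∙ p) h ε as)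

  fold-++ : ∀ {a} {A : Set a} (as bs : List A) (f : A → Carrier) →
    fold (as ++ bs) f ≈ fold as f ∙ fold bs f
  fold-++ []       bs f = ≈-sym (identityˡ _)
  fold-++ (x ∷ as) bs f = ≈-trans (∙-congˡ (fold-++ as bs f)) (≈-sym (assoc _ _ _))

  fold-∙ : ∀ {a} {A : Set a} (as : List A) (f g : A → Carrier) →
    fold as (λ x → f x ∙ g x) ≈ fold as f ∙ fold as g
  fold-∙ []       f g = ≈-sym (identityˡ ε)
  fold-∙ (x ∷ as) f g = ≈-trans (∙-congˡ (fold-∙ as f g)) (interchange _ _ _ _)

  fold-swap : ∀ {a b} {A : Set a} {B : Set b} (as : List A) (bs : List B)
    (f : A → B → Carrier) →
    fold as (λ x → fold bs (f x)) ≈ fold bs (λ y → fold as (λ x → f x y))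
  fold-swap []       bs f = ≈-sym (fold-ε bs λ _ → ≈-refl)
  fold-swap (x ∷ as) bs f =
    ≈-trans (∙-congˡ (fold-swap as bs f)) (≈-sym (fold-∙ bs (f x) _))

  fold-cartesianProductWith : ∀ {a b c} {A : Set a} {B : Set b} {C : Set c}
    (h : A → B → C) (as : List A) (bs : List B) (f : C → Carrier) →
    fold (cartesianProductWith h as bs) f ≈ fold as (λ x → fold bs (λ y → f (h x y)))
  fold-cartesianProductWith h []       bs f = ≈-refl
  fold-cartesianProductWith h (x ∷ as) bs f =
    ≈-trans (fold-++ (map (h x) bs) (cartesianProductWith h as bs) f)
      (∙-cong (fold-map (h x) bs f) (fold-cartesianProductWith h as bs f))

  fold-allFin : ∀ n (f : Fin (suc n) → Carrier) →
    fold (allFin (suc n)) f ≈ f zero ∙ fold (allFin n) (f ∘ suc)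
  fold-allFin n f = ∙-congˡ (≈-trans
    (reflexive (cong (λ as → fold as f) (sym (List.map-tabulate id suc))))
    (fold-map suc (allFin n) f))

  fold-allFin-+ : ∀ m n (f : Fin (m + n) → Carrier) →
    fold (allFin (m + n)) f ≈
    fold (allFin m) (λ i → f (i ↑ˡ n)) ∙ fold (allFin n) (λ j → f (m ↑ʳ j))
  fold-allFin-+ zero    n f = ≈-sym (identityˡ _)
  fold-allFin-+ (suc m) n f = begin
    fold (allFin (suc m + n)) f
      ≈⟨ fold-allFin (m + n) f ⟩
    f zero ∙ fold (allFin (m + n)) (f ∘ suc)
      ≈⟨ ∙-congˡ (fold-allFin-+ m n (f ∘ suc)) ⟩
    f zero ∙ (fold (allFin m) (λ i → f (suc i ↑ˡ n)) ∙ fold (allFin n) (λ j → f (suc m ↑ʳ j)))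
      ≈⟨ assoc _ _ _ ⟨
    (f zero ∙ fold (allFin m) (λ i → f (suc i ↑ˡ n))) ∙ fold (allFin n) (λ j → f (suc m ↑ʳ j))
      ≈⟨ ∙-congʳ (fold-allFin m (λ i → f (i ↑ˡ n))) ⟨
    fold (allFin (suc m)) (λ i → f (i ↑ˡ n)) ∙ fold (allFin n) (λ j → f (suc m ↑ʳ j)) ∎

  fold-single : ∀ {n} (i : Fin n) (f : Fin n → Carrier) →
    (∀ j → j ≢ i → f j ≈ ε) → fold (allFin n) f ≈ f i
  fold-single {suc n} zero f f≈ε = begin
    fold (allFin (suc n)) f              ≈⟨ fold-allFin n f ⟩
    f zero ∙ fold (allFin n) (f ∘ suc)   ≈⟨ ∙-congˡ (fold-ε (allFin n) λ j → f≈ε (suc j) λ ()) ⟩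
    f zero ∙ ε                           ≈⟨ identityʳ _ ⟩
    f zero                               ∎
  fold-single {suc n} (suc i) f f≈ε = begin
    fold (allFin (suc n)) f              ≈⟨ fold-allFin n f ⟩
    f zero ∙ fold (allFin n) (f ∘ suc)   ≈⟨ ∙-cong (f≈ε zero λ ()) (fold-single i (f ∘ suc)
                                              λ j j≢i → f≈ε (suc j) (j≢i ∘ suc-injective)) ⟩
    ε ∙ f (suc i)                        ≈⟨ identityˡ _ ⟩
    f (suc i)                            ∎

  fold-functions : ∀ k N (f : Vec (Fin N) (suc k) → Carrier) →
    fold (functions (suc k) N) f ≈
    fold (allFin N) (λ a → fold (functions k N) (λ g → f (a ∷ g)))
  fold-functions k N = fold-cartesianProductWith _∷_ (allFin N) (functions k N)

  -- A wrong g′ is witnessed by a position of disagreement rather than by `g′ ≢ g`: the position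
  -- later names the mode whose factor vanishes.
  fold-functions-single : ∀ {k N} (g : Vec (Fin N) k) (f : Vec (Fin N) k → Carrier) →
    (∀ g′ i → lookup g′ i ≢ lookup g i → f g′ ≈ ε) → fold (functions k N) f ≈ f g
  fold-functions-single             []      f f≈ε = identityʳ _
  fold-functions-single {suc k} {N} (a ∷ g) f f≈ε = begin
    fold (functions (suc k) N) f
      ≈⟨ fold-functions k N f ⟩
    fold (allFin N) (λ b → fold (functions k N) (λ g′ → f (b ∷ g′)))
      ≈⟨ fold-single a _ (λ b b≢a → fold-ε (functions k N) λ g′ → f≈ε (b ∷ g′) zero b≢a) ⟩
    fold (functions k N) (λ g′ → f (a ∷ g′))
      ≈⟨ fold-functions-single g (λ g′ → f (a ∷ g′)) (λ g′ i → f≈ε (a ∷ g′) (suc i)) ⟩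
    f (a ∷ g) ∎

  -- The enumeration lists the sets containing 0 first, so `omit zero` comes last; commutativity
  -- moves it to the front.
  fold-subsetsOfSize : ∀ h (f : SubsetOfSize h (suc h) → Carrier) →
    fold (subsetsOfSize h (suc h)) f ≈ fold (allFin (suc h)) (f ∘ omit)
  fold-subsetsOfSize zero    f = ≈-refl
  fold-subsetsOfSize (suc h) f = begin
    fold (map with-0 (subsetsOfSize h (suc h)) ++ map without-0 (subsetsOfSize (suc h) (suc h))) f
      ≈⟨ fold-++ (map with-0 (subsetsOfSize h (suc h))) _ f ⟩
    fold (map with-0 (subsetsOfSize h (suc h))) f ∙
    fold (map without-0 (subsetsOfSize (suc h) (suc h))) f
      ≈⟨ ∙-cong (fold-map with-0 (subsetsOfSize h (suc h)) f)
           (reflexive (cong (λ Ss → fold (map without-0 Ss) f) (subsetsOfSize-full (suc h)))) ⟩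
    fold (subsetsOfSize h (suc h)) (f ∘ with-0) ∙ (f (omit zero) ∙ ε)
      ≈⟨ ∙-cong (fold-subsetsOfSize h (f ∘ with-0)) (identityʳ _) ⟩
    fold (allFin (suc h)) (f ∘ omit ∘ suc) ∙ f (omit zero)
      ≈⟨ comm _ _ ⟩
    f (omit zero) ∙ fold (allFin (suc h)) (f ∘ omit ∘ suc)
      ≈⟨ fold-allFin (suc h) (f ∘ omit) ⟨
    fold (allFin (suc (suc h))) (f ∘ omit) ∎
    where
    with-0 : SubsetOfSize h (suc h) → SubsetOfSize (suc h) (suc (suc h))
    with-0 (S , e) = inside ∷ S , cong suc e
    without-0 : SubsetOfSize (suc h) (suc h) → SubsetOfSize (suc h) (suc (suc h))
    without-0 (S , e) = outside ∷ S , e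

module _ {c ℓ₁ ℓ₂ : Level} (F : HeytingField c ℓ₁ ℓ₂) where

  open Over F
  private module F = HeytingField F

  -- The commutative semiring of polynomials

  polynomials : Set → CommutativeSemiring c (c Level.⊔ ℓ₁)
  polynomials V = record
    { Carrier = Poly V
    ; _≈_     = _≋_
    ; _+_     = _⊕_
    ; _*_     = _⊛_
    ; 0#      = con F.0#
    ; 1#      = con F.1#
    ; isCommutativeSemiring = IsCommutativeSemiringˡ.isCommutativeSemiring (record
        { +-isCommutativeMonoid = IsCommutativeMonoidˡ.isCommutativeMonoid (record
            { isSemigroup = record
                { isMagma = record { isEquivalence = isEquivalence ; ∙-cong = ⊕-cong }
                ; assoc = ⊕-assoc }
            ; identityˡ = ⊕-identityˡ
            ; comm = ⊕-comm })
        ; *-isCommutativeMonoid = IsCommutativeMonoidˡ.isCommutativeMonoid (record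
            { isSemigroup = record
                { isMagma = record { isEquivalence = isEquivalence ; ∙-cong = ⊛-cong }
                ; assoc = ⊛-assoc }
            ; identityˡ = ⊛-identityˡ
            ; comm = ⊛-comm })
        ; distribʳ = λ p q r → ≋-trans (⊛-comm _ _)
            (≋-trans (⊛-distribˡ p q r) (⊕-cong (⊛-comm _ _) (⊛-comm _ _)))
        ; zeroˡ = ⊛-zeroˡ
        })
    }
    where
    isEquivalence : IsEquivalence (_≋_ {V})
    isEquivalence = record { refl = ≋-refl ; sym = ≋-sym ; trans = ≋-trans }

  module Polynomials {V : Set} where
    open CommutativeSemiring (polynomials V) public
      using (setoid; reflexive)
      renaming (+-identityʳ to ⊕-identityʳ; *-identityʳ to ⊛-identityʳ; zeroʳ to ⊛-zeroʳ)
    open SetoidReasoning setoid public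

  module ∑ {V : Set} =
    Folds (CommutativeSemiring.+-commutativeMonoid (polynomials V))
  module ∏ {V : Set} =
    Folds (CommutativeSemiring.*-commutativeMonoid (polynomials V))

  module _ {V : Set} where

    open Polynomials {V}

    ⊛-∑ : ∀ {a} {A : Set a} p (as : List A) (f : A → Poly V) →
      p ⊛ ∑ as f ≋ ∑ as (λ x → p ⊛ f x)
    ⊛-∑ p []       f = ⊛-zeroʳ p
    ⊛-∑ p (x ∷ as) f = ≋-trans (⊛-distribˡ p _ _) (⊕-cong ≋-refl (⊛-∑ p as f))

    ∑-⊛ : ∀ {a} {A : Set a} (as : List A) (f : A → Poly V) p →
      ∑ as f ⊛ p ≋ ∑ as (λ x → f x ⊛ p)
    ∑-⊛ as f p = ≋-trans (⊛-comm _ p)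
      (≋-trans (⊛-∑ p as f) (∑.fold-cong as λ x → ⊛-comm p _))

    ∏-zero : ∀ {n} (i : Fin n) (f : Fin n → Poly V) → f i ≋ con F.0# →
      ∏ (allFin n) f ≋ con F.0#
    ∏-zero {suc n} zero    f fi≋0 = ≋-trans (∏.fold-allFin n f)
      (≋-trans (⊛-cong fi≋0 ≋-refl) (⊛-zeroˡ _))
    ∏-zero {suc n} (suc i) f fi≋0 = ≋-trans (∏.fold-allFin n f)
      (≋-trans (⊛-cong ≋-refl (∏-zero i (f ∘ suc) fi≋0)) (⊛-zeroʳ _))

    -- Expanding the product chooses one summand from each factor, and the choices form a function
    -- g. This trades a sum of N^k terms for k sums of N terms.
    ∑-∏-distrib : ∀ k N (f : Fin k → Fin N → Poly V) →
      ∑ (functions k N) (λ g → ∏ (allFin k) λ i → f i (lookup g i)) ≋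
      ∏ (allFin k) (λ i → ∑ (allFin N) (f i))
    ∑-∏-distrib zero    N f = ⊕-identityʳ _
    ∑-∏-distrib (suc k) N f = begin
      ∑ (functions (suc k) N) (λ g → ∏ (allFin (suc k)) λ i → f i (lookup g i))
        ≈⟨ ∑.fold-functions k N _ ⟩
      ∑ (allFin N) (λ a → ∑ (functions k N) λ g →
        ∏ (allFin (suc k)) λ i → f i (lookup (a ∷ g) i))
        ≈⟨ (∑.fold-cong (allFin N) λ a → ∑.fold-cong (functions k N) λ g →
             ∏.fold-allFin k _) ⟩
      ∑ (allFin N) (λ a → ∑ (functions k N) λ g → f zero a ⊛ rest g)
        ≈⟨ ∑.fold-cong (allFin N) (λ a → ⊛-∑ (f zero a) (functions k N) rest) ⟨
      ∑ (allFin N) (λ a → f zero a ⊛ ∑ (functions k N) rest)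
        ≈⟨ ∑-⊛ (allFin N) (f zero) (∑ (functions k N) rest) ⟨
      ∑ (allFin N) (f zero) ⊛ ∑ (functions k N) rest
        ≈⟨ ⊛-cong ≋-refl (∑-∏-distrib k N (f ∘ suc)) ⟩
      ∑ (allFin N) (f zero) ⊛ ∏ (allFin k) (λ i → ∑ (allFin N) (f (suc i)))
        ≈⟨ ∏.fold-allFin k (λ i → ∑ (allFin N) (f i)) ⟨
      ∏ (allFin (suc k)) (λ i → ∑ (allFin N) (f i)) ∎
      where
      rest : Vec (Fin N) k → Poly V
      rest g = ∏ (allFin k) λ i → f (suc i) (lookup g i)

  -- Substitution and complexity

  leaf : {V : Set} → F.Carrier ⊎ V → Poly V
  leaf = [ con , var ]′

  -- Only constants and variables may be put for a variable, so that in a circuit sources stay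
  -- sources and no wire is added.
  substitute : {V W : Set} → (V → F.Carrier ⊎ W) → Poly V → Poly W
  substitute ρ (con a) = con a
  substitute ρ (var x) = leaf (ρ x)
  substitute ρ (p ⊕ q) = substitute ρ p ⊕ substitute ρ q
  substitute ρ (p ⊛ q) = substitute ρ p ⊛ substitute ρ q

  module _ {V W : Set} (ρ : V → F.Carrier ⊎ W) where

    substitute-cong : ∀ {p q} → p ≋ q → substitute ρ p ≋ substitute ρ q
    substitute-cong ≋-refl              = ≋-refl
    substitute-cong (≋-sym p≋q)         = ≋-sym (substitute-cong p≋q)
    substitute-cong (≋-trans p≋q q≋r)   = ≋-trans (substitute-cong p≋q) (substitute-cong q≋r)
    substitute-cong (⊕-cong p≋p′ q≋q′)  = ⊕-cong (substitute-cong p≋p′) (substitute-cong q≋q′)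
    substitute-cong (⊛-cong p≋p′ q≋q′)  = ⊛-cong (substitute-cong p≋p′) (substitute-cong q≋q′)
    substitute-cong (⊕-assoc p q r)     = ⊕-assoc _ _ _
    substitute-cong (⊕-comm p q)        = ⊕-comm _ _
    substitute-cong (⊕-identityˡ p)     = ⊕-identityˡ _
    substitute-cong (⊛-assoc p q r)     = ⊛-assoc _ _ _
    substitute-cong (⊛-comm p q)        = ⊛-comm _ _
    substitute-cong (⊛-identityˡ p)     = ⊛-identityˡ _
    substitute-cong (⊛-distribˡ p q r)  = ⊛-distribˡ _ _ _
    substitute-cong (⊛-zeroˡ p)         = ⊛-zeroˡ _
    substitute-cong (con-cong a≈b)      = con-cong a≈b
    substitute-cong (con-+ a b)         = con-+ a b
    substitute-cong (con-* a b)         = con-* a b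

    substitute-∑ : ∀ {a} {A : Set a} (as : List A) {f : A → Poly V} {g : A → Poly W} →
      (∀ x → substitute ρ (f x) ≡ g x) → substitute ρ (∑ as f) ≡ ∑ as g
    substitute-∑ []       f≡g = refl
    substitute-∑ (x ∷ as) f≡g = cong₂ _⊕_ (f≡g x) (substitute-∑ as f≡g)

    substitute-∏ : ∀ {a} {A : Set a} (as : List A) {f : A → Poly V} {g : A → Poly W} →
      (∀ x → substitute ρ (f x) ≡ g x) → substitute ρ (∏ as f) ≡ ∏ as g
    substitute-∏ []       f≡g = refl
    substitute-∏ (x ∷ as) f≡g = cong₂ _⊛_ (f≡g x) (substitute-∏ as f≡g)

    substituteVertex : ∀ {n} → Vertex V n → Vertex W n
    substituteVertex (const a)    = const a
    substituteVertex (input x)    = [ const , input ]′ (ρ x)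
    substituteVertex (gate op ws) = gate op ws

    substituteDag : ∀ {n} → Dag V n → Dag W n
    substituteDag []      = []
    substituteDag (D ▷ v) = substituteDag D ▷ substituteVertex v

    wires-substituteVertex : ∀ {n} (v : Vertex V n) → wires (substituteVertex v) ≡ wires v
    wires-substituteVertex (const a)    = refl
    wires-substituteVertex (input x) with ρ x
    ... | inj₁ a = refl
    ... | inj₂ y = refl
    wires-substituteVertex (gate op ws) = refl

    dagSize-substituteDag : ∀ {n} (D : Dag V n) → dagSize (substituteDag D) ≡ dagSize D
    dagSize-substituteDag []      = refl
    dagSize-substituteDag (D ▷ v) =
      cong₂ _+_ (dagSize-substituteDag D) (wires-substituteVertex v)

    vertexValue-substituteVertex : ∀ {n} (v : Vertex V n) (ps : Vec (Poly V) n) →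
      vertexValue (substituteVertex v) (Vec.map (substitute ρ) ps) ≡
      substitute ρ (vertexValue v ps)
    vertexValue-substituteVertex (const a) ps = refl
    vertexValue-substituteVertex (input x) ps with ρ x
    ... | inj₁ a = refl
    ... | inj₂ y = refl
    vertexValue-substituteVertex (gate plus ws) ps =
      sym (substitute-∑ (List⁺.toList ws) λ (a , i) →
        cong (con a ⊛_) (sym (Vec.lookup-map i (substitute ρ) ps)))
    vertexValue-substituteVertex (gate times ws) ps =
      sym (substitute-∏ (List⁺.toList ws) λ (a , i) →
        cong (con a ⊛_) (sym (Vec.lookup-map i (substitute ρ) ps)))

    values-substituteDag : ∀ {n} (D : Dag V n) →
      values (substituteDag D) ≡ Vec.map (substitute ρ) (values D)
    values-substituteDag []      = refl
    values-substituteDag (D ▷ v) rewrite values-substituteDag D =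
      cong (_∷ Vec.map (substitute ρ) (values D)) (vertexValue-substituteVertex v (values D))

    C≤-substitute : ∀ {p : Poly V} {s} → C[ p ]≤ s → C[ substitute ρ p ]≤ s
    C≤-substitute {p} ((n , D) , (i , Di≋p) , D≤s) =
      (n , substituteDag D) ,
      (i , ≋-trans (reflexive value) (substitute-cong Di≋p)) ,
      ≤-trans (≤-reflexive (dagSize-substituteDag D)) D≤s
      where
      open Polynomials using (reflexive)
      value : lookup (values (substituteDag D)) i ≡ substitute ρ (lookup (values D) i)
      value = trans (cong (λ ps → lookup ps i) (values-substituteDag D))
                    (Vec.lookup-map i (substitute ρ) (values D))

  -- Disjoint unions of circuits, and formulas as circuits

  module _ {V : Set} where

    weaken : ∀ {m} n → Vertex V m → Vertex V (m + n)
    weaken n (const a)    = const a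
    weaken n (input x)    = input x
    weaken n (gate op ws) = gate op (List⁺.map (map₂ (_↑ˡ n)) ws)

    infixl 5 _⧺_

    -- E precedes D in the topological order. Since index zero is the latest vertex, the vertices of
    -- D keep their numbers and those of E are shifted by m.
    _⧺_ : ∀ {m n} → Dag V m → Dag V n → Dag V (m + n)
    []      ⧺ E = E
    (D ▷ v) ⧺ E = (D ⧺ E) ▷ weaken _ v

    wires-weaken : ∀ {m} n (v : Vertex V m) → wires (weaken n v) ≡ wires v
    wires-weaken n (const a)          = refl
    wires-weaken n (input x)          = refl
    wires-weaken n (gate op (w ∷ ws)) = cong suc (List.length-map _ ws)

    dagSize-⧺ : ∀ {m n} (D : Dag V m) (E : Dag V n) →
      dagSize (D ⧺ E) ≡ dagSize D + dagSize E
    dagSize-⧺ []      E = refl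
    dagSize-⧺ {n = n} (D ▷ v) E = begin
      dagSize (D ⧺ E) + wires (weaken n v)  ≡⟨ cong₂ _+_ (dagSize-⧺ D E) (wires-weaken n v) ⟩
      dagSize D + dagSize E + wires v       ≡⟨ xy∙z≈xz∙y (dagSize D) (dagSize E) (wires v) ⟩
      dagSize D + wires v + dagSize E       ∎
      where
      open ≡-Reasoning
      open CommutativeSemigroupProperties +-commutativeSemigroup using (xy∙z≈xz∙y)

    wireValue : ∀ {n} → Vec (Poly V) n → Wire n → Poly V
    wireValue ps (a , i) = con a ⊛ lookup ps i

    foldr-weaken : ∀ {m n} (_∙_ : Poly V → Poly V → Poly V) e
      (ps : Vec (Poly V) m) (qs : Vec (Poly V) n) (ws : List (Wire m)) →
      foldr (λ w p → wireValue (ps Vec.++ qs) w ∙ p) e (map (map₂ (_↑ˡ n)) ws) ≡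
      foldr (λ w p → wireValue ps w ∙ p) e ws
    foldr-weaken _∙_ e ps qs ws = trans (List.foldr-map _ _ e ws)
      (List.foldr-cong (λ (a , i) p → cong (λ q → (con a ⊛ q) ∙ p) (Vec.lookup-++ˡ ps qs i))
        refl ws)

    vertexValue-weaken : ∀ {m n} (v : Vertex V m) (ps : Vec (Poly V) m) (qs : Vec (Poly V) n) →
      vertexValue (weaken n v) (ps Vec.++ qs) ≡ vertexValue v ps
    vertexValue-weaken (const a)             ps qs = refl
    vertexValue-weaken (input x)             ps qs = refl
    vertexValue-weaken (gate plus (w ∷ ws))  ps qs = foldr-weaken _⊕_ _ ps qs (w ∷ ws)
    vertexValue-weaken (gate times (w ∷ ws)) ps qs = foldr-weaken _⊛_ _ ps qs (w ∷ ws)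

    values-⧺ : ∀ {m n} (D : Dag V m) (E : Dag V n) →
      values (D ⧺ E) ≡ values D Vec.++ values E
    values-⧺ []      E = refl
    values-⧺ (D ▷ v) E rewrite values-⧺ D E =
      cong (_∷ (values D Vec.++ values E)) (vertexValue-weaken v (values D) (values E))

    open Polynomials {V} using (reflexive; ⊕-identityʳ; ⊛-identityʳ)

    C≤-resp-≋ : ∀ {p q : Poly V} {s} → p ≋ q → C[ p ]≤ s → C[ q ]≤ s
    C≤-resp-≋ p≋q (Γ , (i , Γi≋p) , Γ≤s) = Γ , (i , ≋-trans Γi≋p p≋q) , Γ≤s

    C≤-mono : ∀ {p : Poly V} {s t} → s ≤ t → C[ p ]≤ s → C[ p ]≤ t
    C≤-mono s≤t (Γ , Γp , Γ≤s) = Γ , Γp , ≤-trans Γ≤s s≤t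

    -- One new gate with two wires labelled 1 is put on the disjoint union of the circuits; these
    -- wires are the 2 in the bound. The hypothesis on the gate's value lets one construction serve
    -- both operations.
    join : ∀ {p q : Poly V} {s t} op r →
      (∀ {n} (ps : Vec (Poly V) n) i j → lookup ps i ≋ p → lookup ps j ≋ q →
        vertexValue (gate op ((F.1# , i) ∷ (F.1# , j) ∷ [])) ps ≋ r) →
      C[ p ]≤ s → C[ q ]≤ t → C[ r ]≤ (s + t + 2)
    join op r value ((m , D) , (i , Di≋p) , D≤s) ((n , E) , (j , Ej≋q) , E≤t) =
      (suc (m + n) , (D ⧺ E) ▷ gate op ((F.1# , i ↑ˡ n) ∷ (F.1# , m ↑ʳ j) ∷ [])) ,
      (zero , value (values (D ⧺ E)) (i ↑ˡ n) (m ↑ʳ j)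
        (≋-trans (reflexive valueˡ) Di≋p) (≋-trans (reflexive valueʳ) Ej≋q)) ,
      +-mono-≤ (≤-trans (≤-reflexive (dagSize-⧺ D E)) (+-mono-≤ D≤s E≤t)) ≤-refl
      where
      valueˡ : lookup (values (D ⧺ E)) (i ↑ˡ n) ≡ lookup (values D) i
      valueˡ = trans (cong (λ ps → lookup ps (i ↑ˡ n)) (values-⧺ D E))
                     (Vec.lookup-++ˡ (values D) (values E) i)
      valueʳ : lookup (values (D ⧺ E)) (m ↑ʳ j) ≡ lookup (values E) j
      valueʳ = trans (cong (λ ps → lookup ps (m ↑ʳ j)) (values-⧺ D E))
                     (Vec.lookup-++ʳ (values D) (values E) j)

    -- Wires of the tree-shaped circuit of an expression, two for each operation. The number depends
    -- on the expression and not just on its class modulo `_≋_`, so small circuits come from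
    -- exhibiting short expressions.
    formulaSize : Poly V → ℕ
    formulaSize (con a) = 0
    formulaSize (var x) = 0
    formulaSize (p ⊕ q) = formulaSize p + formulaSize q + 2
    formulaSize (p ⊛ q) = formulaSize p + formulaSize q + 2

    C≤formulaSize : ∀ p → C[ p ]≤ formulaSize p
    C≤formulaSize (con a) = (1 , [] ▷ const a) , (zero , ≋-refl) , z≤n
    C≤formulaSize (var x) = (1 , [] ▷ input x) , (zero , ≋-refl) , z≤n
    C≤formulaSize (p ⊕ q) = join plus (p ⊕ q)
      (λ ps i j i≋p j≋q → ⊕-cong (≋-trans (⊛-identityˡ _) i≋p)
        (≋-trans (⊕-identityʳ _) (≋-trans (⊛-identityˡ _) j≋q)))
      (C≤formulaSize p) (C≤formulaSize q)
    C≤formulaSize (p ⊛ q) = join times (p ⊛ q)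
      (λ ps i j i≋p j≋q → ⊛-cong (≋-trans (⊛-identityˡ _) i≋p)
        (≋-trans (⊛-identityʳ _) (≋-trans (⊛-identityˡ _) j≋q)))
      (C≤formulaSize p) (C≤formulaSize q)

    -- Each step of the fold pays b for its entry and 2 for the operation; the closing constant is
    -- free.
    formulaSize-foldr : ∀ {n b} {_∙_ : Poly V → Poly V → Poly V} {a} →
      (∀ p q → formulaSize (p ∙ q) ≡ formulaSize p + formulaSize q + 2) →
      (f : Fin n → Poly V) → (∀ i → formulaSize (f i) ≡ b) →
      formulaSize (foldr (λ i p → f i ∙ p) (con a) (allFin n)) ≡ n * (b + 2)
    formulaSize-foldr {n} {b} {_∙_} {a} size-∙ f f≡b = trans (go (allFin n))
      (cong (_* (b + 2)) (List.length-tabulate {n = n} id))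
      where
      open ≡-Reasoning
      open CommutativeSemigroupProperties +-commutativeSemigroup using (xy∙z≈xz∙y)
      foldSize = λ is → formulaSize (foldr (λ i p → f i ∙ p) (con a) is)
      go : ∀ is → foldSize is ≡ length is * (b + 2)
      go []       = refl
      go (i ∷ is) = begin
        foldSize (i ∷ is)                 ≡⟨ size-∙ _ _ ⟩
        formulaSize (f i) + foldSize is + 2 ≡⟨ cong (_+ 2) (cong₂ _+_ (f≡b i) (go is)) ⟩
        b + length is * (b + 2) + 2       ≡⟨ xy∙z≈xz∙y b (length is * (b + 2)) 2 ⟩
        b + 2 + length is * (b + 2)       ∎

    formulaSize-∑ : ∀ {n b} (f : Fin n → Poly V) → (∀ i → formulaSize (f i) ≡ b) →
      formulaSize (∑ (allFin n) f) ≡ n * (b + 2)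
    formulaSize-∑ = formulaSize-foldr {_∙_ = _⊕_} λ _ _ → refl

    formulaSize-∏ : ∀ {n b} (f : Fin n → Poly V) → (∀ i → formulaSize (f i) ≡ b) →
      formulaSize (∏ (allFin n) f) ≡ n * (b + 2)
    formulaSize-∏ = formulaSize-foldr {_∙_ = _⊛_} λ _ _ → refl

  -- The tensors T_i and their product

  -- The value of `poly T` with an arbitrary polynomial `φ i x` put for each variable. Varying φ
  -- lets the first factor of a Kronecker product be summed out, leaving an evaluation of the
  -- remaining factor.
  evaluate : ∀ {d} {X : Fin d → Set} {V : Set} →
    (∀ i → X i → Poly V) → Tensor X → Poly V
  evaluate {d} φ T = ∑ T λ (a , x) → con a ⊛ ∏ (allFin d) λ i → φ i (x i)

  substitute-poly : ∀ {d} {X : Fin d → Set} {V : Set} (ρ : Var X → F.Carrier ⊎ V)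
    (T : Tensor X) → substitute ρ (poly T) ≡ evaluate (λ i x → leaf (ρ (i , x))) T
  substitute-poly {d} ρ T = substitute-∑ ρ T λ (a , x) →
    cong (con a ⊛_) (substitute-∏ ρ (allFin d) λ _ → refl)

  evaluate-cong : ∀ {d} {X : Fin d → Set} {V : Set} (φ ψ : ∀ i → X i → Poly V) →
    (∀ i x → φ i x ≋ ψ i x) → (T : Tensor X) → evaluate φ T ≋ evaluate ψ T
  evaluate-cong {d} φ ψ φ≋ψ T = ∑.fold-cong T λ (a , x) →
    ⊛-cong ≋-refl (∏.fold-cong (allFin d) λ i → φ≋ψ i (x i))

  -- Every term has a variable from mode i, hence a vanishing factor.
  evaluate-zero : ∀ {d} {X : Fin d → Set} {V : Set} (φ : ∀ i → X i → Poly V) i →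
    (∀ x → φ i x ≋ con F.0#) → (T : Tensor X) → evaluate φ T ≋ con F.0#
  evaluate-zero φ i φi≋0 T = ∑.fold-ε T λ (a , x) →
    ≋-trans (⊛-cong ≋-refl (∏-zero i _ (φi≋0 (x i)))) (Polynomials.⊛-zeroʳ _)

  -- Mode i sees f only at the point `τ i`. The T_i are the case where τ comes from `modes`.
  blocks : ∀ {d k} → (Fin d → Fin k) → ∀ N → Tensor {d} (λ _ → Fin N)
  blocks {k = k} τ N = map (λ f → F.1# , λ i → lookup f (τ i)) (functions k N)

  evaluate-blocks : ∀ {d k N} {V : Set} (τ : Fin d → Fin k) (φ : Fin d → Fin N → Poly V) →
    evaluate φ (blocks τ N) ≋
    ∑ (functions k N) λ f → ∏ (allFin d) λ i → φ i (lookup f (τ i))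
  evaluate-blocks {k = k} {N} τ φ = ≋-trans (∑.fold-map _ (functions k N) _)
    (∑.fold-cong (functions k N) λ f → ⊛-identityˡ _)

  evaluate-blocks-⊗ : ∀ {d k N} {Y : Fin d → Set} {V : Set} (τ : Fin d → Fin k)
    (U : Tensor Y) (φ : ∀ i → Fin N × Y i → Poly V) →
    evaluate φ (blocks τ N ⊗ U) ≋
    ∑ (functions k N) λ f → evaluate (λ i y → φ i (lookup f (τ i) , y)) U
  evaluate-blocks-⊗ {k = k} {N} τ U φ =
    ≋-trans (∑.fold-cartesianProductWith _ (blocks τ N) U _)
    (≋-trans (∑.fold-map _ (functions k N) _)
    (∑.fold-cong (functions k N) λ f → ∑.fold-cong U λ (b , y) →
      ⊛-cong (con-cong (F.*-identityˡ b)) ≋-refl))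

  -- The modes are sorted by the point `τ i` on which they depend. Modes belonging to another point
  -- contribute a factor 1, which keeps all inner products over the same d modes at a cost
  -- independent of N per summand.
  blocksFormula : ∀ {d k} → (Fin d → Fin k) → ∀ N → Poly (Var {d} (λ _ → Fin N))
  blocksFormula {d} {k} τ N = ∏ (allFin k) λ m → ∑ (allFin N) λ a → ∏ (allFin d) λ i →
    if does (τ i ≟ m) then var (i , a) else con F.1#

  -- Each variable is padded with factors 1 to a product over all m, the variable itself sitting at
  -- m = `τ i`. Exchanging the products makes the m-th factor depend on f(m) alone, so
  -- distributivity applies.
  poly-blocks : ∀ {d k} (τ : Fin d → Fin k) N → poly (blocks τ N) ≋ blocksFormula τ N
  poly-blocks {d} {k} τ N = begin
    poly (blocks τ N)
      ≈⟨ evaluate-blocks τ (λ i a → var (i , a)) ⟩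
    ∑ (functions k N) (λ f → ∏ (allFin d) λ i → var (i , lookup f (τ i)))
      ≈⟨ (∑.fold-cong (functions k N) λ f → ∏.fold-cong (allFin d) λ i → sort f i) ⟩
    ∑ (functions k N) (λ f → ∏ (allFin d) λ i → ∏ (allFin k) λ m → factor i m (lookup f m))
      ≈⟨ (∑.fold-cong (functions k N) λ f → ∏.fold-swap (allFin d) (allFin k) _) ⟩
    ∑ (functions k N) (λ f → ∏ (allFin k) λ m → ∏ (allFin d) λ i → factor i m (lookup f m))
      ≈⟨ ∑-∏-distrib k N (λ m a → ∏ (allFin d) λ i → factor i m a) ⟩
    blocksFormula τ N ∎
    where
    open Polynomials
    factor : Fin d → Fin k → Fin N → Poly (Var {d} (λ _ → Fin N))
    factor i m a = if does (τ i ≟ m) then var (i , a) else con F.1#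
    factor-≡ : ∀ i a → factor i (τ i) a ≡ var (i , a)
    factor-≡ i a rewrite dec-true (τ i ≟ τ i) refl = refl
    factor-≢ : ∀ i m a → m ≢ τ i → factor i m a ≡ con F.1#
    factor-≢ i m a m≢τi rewrite dec-false (τ i ≟ m) (m≢τi ∘ sym) = refl
    sort : ∀ f i → var (i , lookup f (τ i)) ≋ ∏ (allFin k) λ m → factor i m (lookup f m)
    sort f i = ≋-sym (≋-trans
      (∏.fold-single (τ i) _ λ m m≢τi → reflexive (factor-≢ i m _ m≢τi))
      (reflexive (factor-≡ i _)))

  blocksConstant : (d k : ℕ) → ℕ
  blocksConstant d k = k * (d * 2 + 4)

  C≤-blocks : ∀ {d k} (τ : Fin d → Fin k) n →
    C[ poly (blocks τ (suc n)) ]≤ (blocksConstant d k * suc n)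
  C≤-blocks {d} {k} τ n = C≤-mono bound
    (C≤-resp-≋ (≋-sym (poly-blocks τ (suc n))) (C≤formulaSize (blocksFormula τ (suc n))))
    where
    N = suc n
    factorSize : ∀ m a i → formulaSize {Var {d} (λ _ → Fin N)}
      (if does (τ i ≟ m) then var (i , a) else con F.1#) ≡ 0
    factorSize m a i with does (τ i ≟ m)
    ... | true  = refl
    ... | false = refl
    open ≤-Reasoning
    bound : formulaSize (blocksFormula τ N) ≤ blocksConstant d k * N
    bound = begin
      formulaSize (blocksFormula τ N)
        ≡⟨ (formulaSize-∏ {n = k} _ λ m → formulaSize-∑ {n = N} _ λ a →
             formulaSize-∏ {n = d} _ (factorSize m a)) ⟩
      k * (N * (d * 2 + 2) + 2)
        -- N is a successor, so the 2 wires per factor of the outer product are absorbed by N * 2.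
        ≤⟨ *-monoʳ-≤ k (+-monoʳ-≤ (N * (d * 2 + 2)) (m≤n*m 2 N)) ⟩
      k * (N * (d * 2 + 2) + N * 2)
        ≡⟨ cong (k *_) (*-distribˡ-+ N (d * 2 + 2) 2) ⟨
      k * (N * (d * 2 + 2 + 2))
        ≡⟨ cong (λ e → k * (N * e)) (+-assoc (d * 2) 2 2) ⟩
      k * (N * (d * 2 + 4))
        ≡⟨ cong (k *_) (*-comm N (d * 2 + 4)) ⟩
      k * ((d * 2 + 4) * N)
        ≡⟨ *-assoc k (d * 2 + 4) N ⟨
      blocksConstant d k * N ∎

  -- Nested pairs rather than vectors, so that the modes of a Kronecker product built one factor at
  -- a time are definitionally of this form.
  Power : ℕ → ℕ → Set
  Power N zero    = ⊤
  Power N (suc r) = Fin N × Power N r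

  Power-finiteNonempty : ∀ n r → FiniteNonempty (Power (suc n) r)
  Power-finiteNonempty n zero    = zero , ↔-sym 1↔⊤
  Power-finiteNonempty n (suc r) with m , P↔ ← Power-finiteNonempty n r =
    -- The product (n + 1)(m + 1) is the successor of this number.
    m + n * suc m , (↔-sym *↔× ↔-∘ (↔-id _ ×-↔ P↔))

  toVec : ∀ {N} r → Power N r → Vec (Fin N) r
  toVec zero    tt      = []
  toVec (suc r) (a , c) = a ∷ toVec r c

  -- The empty product is a single term on one-element modes, a unit for `_⊗_` up to renaming
  -- variables.
  blocksProduct : ∀ {d k} N r → (Fin r → Fin d → Fin k) → Tensor {d} (λ _ → Power N r)
  blocksProduct N zero    τ = [ F.1# , (λ _ → tt) ]
  blocksProduct N (suc r) τ = blocks (τ zero) N ⊗ blocksProduct N r (τ ∘ suc)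

  -- Submultiplicativity is applied once per factor, each contributing `blocksConstant d k` times N;
  -- the remaining d * 2 + 4 is the formula size of the empty product.
  C≤-blocksProduct : ∀ {d k} → Submultiplicative d → ∀ n r (τ : Fin r → Fin d → Fin k) →
    C[ poly (blocksProduct (suc n) r τ) ]≤
      (blocksConstant d k ^ r * (d * 2 + 4) * suc n ^ r)
  C≤-blocksProduct {d} {k} sub n zero τ = C≤-mono (≤-reflexive base) (C≤formulaSize _)
    where
    open ≡-Reasoning
    base : formulaSize (poly (blocksProduct {d} {k} (suc n) zero τ)) ≡ 1 * (d * 2 + 4) * 1
    base = begin
      formulaSize (∏ (allFin d) (λ i → var (i , tt))) + 2 + 0 + 2
        ≡⟨ cong (λ s → s + 2 + 0 + 2) (formulaSize-∏ {n = d} _ λ _ → refl) ⟩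
      d * 2 + 2 + 0 + 2         ≡⟨ cong (_+ 2) (+-identityʳ (d * 2 + 2)) ⟩
      d * 2 + 2 + 2             ≡⟨ +-assoc (d * 2) 2 2 ⟩
      d * 2 + 4                 ≡⟨ *-identityˡ (d * 2 + 4) ⟨
      1 * (d * 2 + 4)           ≡⟨ *-identityʳ (1 * (d * 2 + 4)) ⟨
      1 * (d * 2 + 4) * 1       ∎
  C≤-blocksProduct {d} {k} sub n (suc r) τ = C≤-mono (≤-reflexive bound)
    (sub (λ _ → Fin N) (λ _ → Power N r) (λ _ → n , ↔-id _) (λ _ → Power-finiteNonempty n r)
      (blocks (τ zero) N) (blocksProduct N r (τ ∘ suc)) _ _
      (C≤-blocks (τ zero) n) (C≤-blocksProduct sub n r (τ ∘ suc)))
    where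
    N = suc n
    B = blocksConstant d k
    open ≡-Reasoning
    bound : B * N * (B ^ r * (d * 2 + 4) * N ^ r) ≡ B ^ suc r * (d * 2 + 4) * N ^ suc r
    bound = begin
      B * N * (B ^ r * (d * 2 + 4) * N ^ r)
        ≡⟨ [m*n]*[o*p]≡[m*o]*[n*p] B N (B ^ r * (d * 2 + 4)) (N ^ r) ⟩
      B * (B ^ r * (d * 2 + 4)) * N ^ suc r
        ≡⟨ cong (_* N ^ suc r) (*-assoc B (B ^ r) (d * 2 + 4)) ⟨
      B ^ suc r * (d * 2 + 4) * N ^ suc r ∎

  -- Gluing the factors along the q-modes

  agree : ∀ {N r} → Fin N → Vec (Fin N) r → F.Carrier
  agree a []       = F.1#
  agree a (b ∷ bs) = if does (a ≟ b) then agree a bs else F.0#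

  -- The first k modes are the e_j, the last k the q_m.
  modes : ∀ {k r} → (Fin r → Fin k → Fin k) → Fin r → Fin (k + k) → Fin k
  modes {k} σ i = [ σ i , id ]′ ∘ splitAt k

  module _ {k N : ℕ} {V : Set} where

    -- The substitution once an earlier factor has chosen f: each q_m requires the r coordinates
    -- still to come to equal f(m). In its recursive uses E has already absorbed the earlier
    -- coordinates of the e_j.
    pinned : ∀ r → (Fin k → Vec (Fin N) r → Poly V) → Vec (Fin N) k →
      Fin (k + k) → Power N r → Poly V
    pinned r E f i c =
      [ (λ j → E j (toVec r c)) , (λ m → con (agree (lookup f m) (toVec r c))) ]′ (splitAt k i)

    diagonal : ∀ {r} → (Fin r → Fin k → Fin k) → (Fin k → Vec (Fin N) r → Poly V) →
      Vec (Fin N) k → Poly V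
    diagonal σ E f = ∏ (allFin k) λ j → E j (tabulate λ i → lookup f (σ i j))

    -- Induction on the number of remaining factors. In the next factor only the summand g = f
    -- survives, and its coordinate f(`σ zero j`) is moved into `E j`.
    evaluate-pinned : ∀ r (σ : Fin r → Fin k → Fin k) E f →
      evaluate (pinned r E f) (blocksProduct N r (modes σ)) ≋ diagonal σ E f
    evaluate-pinned zero σ E f = begin
      con F.1# ⊛ ∏ (allFin (k + k)) (λ i → pinned 0 E f i tt) ⊕ con F.0#
        ≈⟨ ⊕-identityʳ _ ⟩
      con F.1# ⊛ ∏ (allFin (k + k)) (λ i → pinned 0 E f i tt)
        ≈⟨ ⊛-identityˡ _ ⟩
      ∏ (allFin (k + k)) (λ i → pinned 0 E f i tt)
        ≈⟨ ∏.fold-allFin-+ k k _ ⟩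
      ∏ (allFin k) (λ j → pinned 0 E f (j ↑ˡ k) tt) ⊛
      ∏ (allFin k) (λ m → pinned 0 E f (k ↑ʳ m) tt)
        ≈⟨ ⊛-cong (∏.fold-cong (allFin k) λ j → reflexive (e-factor j))
                  (∏.fold-ε (allFin k) λ m → reflexive (q-factor m)) ⟩
      diagonal σ E f ⊛ con F.1#
        ≈⟨ ⊛-identityʳ _ ⟩
      diagonal σ E f ∎
      where
      open Polynomials
      e-factor : ∀ j → pinned 0 E f (j ↑ˡ k) tt ≡ E j []
      e-factor j rewrite splitAt-↑ˡ k j k = refl
      q-factor : ∀ m → pinned 0 E f (k ↑ʳ m) tt ≡ con F.1#
      q-factor m rewrite splitAt-↑ʳ k k m = refl
    evaluate-pinned (suc r) σ E f = begin
      evaluate (pinned (suc r) E f) (blocksProduct N (suc r) (modes σ))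
        ≈⟨ evaluate-blocks-⊗ (modes σ zero) rest (pinned (suc r) E f) ⟩
      ∑ (functions k N) (λ g → evaluate (head g) rest)
        -- At a position m where g and f differ, the whole mode q_m evaluates to 0, whatever the
        -- later coordinates are.
        ≈⟨ ∑.fold-functions-single f _ (λ g m gm≢fm →
             evaluate-zero (head g) (k ↑ʳ m) (λ c → reflexive (disagree g m gm≢fm c)) rest) ⟩
      evaluate (head f) rest
        ≈⟨ evaluate-cong (head f) (pinned r E′ f) (λ i c → reflexive (head-f i c)) rest ⟩
      evaluate (pinned r E′ f) rest
        ≈⟨ evaluate-pinned r (σ ∘ suc) E′ f ⟩
      diagonal σ E f ∎
      where
      open Polynomials
      rest = blocksProduct N r (modes (σ ∘ suc))
      head : Vec (Fin N) k → Fin (k + k) → Power N r → Poly V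
      head g i c = pinned (suc r) E f i (lookup g (modes σ zero i) , c)
      E′ : Fin k → Vec (Fin N) r → Poly V
      E′ j v = E j (lookup f (σ zero j) ∷ v)
      disagree : ∀ g m → lookup g m ≢ lookup f m → ∀ c → head g (k ↑ʳ m) c ≡ con F.0#
      disagree g m gm≢fm c
        rewrite splitAt-↑ʳ k k m
              | dec-false (lookup f m ≟ lookup g m) (gm≢fm ∘ sym) = refl
      head-f : ∀ i c → head f i c ≡ pinned r E′ f i c
      head-f i c with splitAt k i
      ... | inj₁ j = refl
      ... | inj₂ m rewrite dec-true (lookup f m ≟ lookup f m) refl = refl

    -- Here no f is fixed yet: the first coordinate of a q_m-variable is the reference with which
    -- the others are compared.
    glued : ∀ r → (Fin k → Vec (Fin N) (suc r) → Poly V) →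
      Fin (k + k) → Power N (suc r) → Poly V
    glued r E i (a , c) =
      [ (λ j → E j (a ∷ toVec r c)) , (λ m → con (agree a (toVec r c))) ]′ (splitAt k i)

    -- The f of the first factor stays as the summation variable; once fixed, it pins all the other
    -- factors.
    evaluate-glued : ∀ r (σ : Fin (suc r) → Fin k → Fin k) E →
      evaluate (glued r E) (blocksProduct N (suc r) (modes σ)) ≋
      ∑ (functions k N) (diagonal σ E)
    evaluate-glued r σ E = begin
      evaluate (glued r E) (blocksProduct N (suc r) (modes σ))
        ≈⟨ evaluate-blocks-⊗ (modes σ zero) rest (glued r E) ⟩
      ∑ (functions k N) (λ f → evaluate (head f) rest)
        ≈⟨ (∑.fold-cong (functions k N) λ f →
             evaluate-cong (head f) (pinned r (E′ f) f) (λ i c → reflexive (head-f f i c)) rest) ⟩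
      ∑ (functions k N) (λ f → evaluate (pinned r (E′ f) f) rest)
        ≈⟨ (∑.fold-cong (functions k N) λ f → evaluate-pinned r (σ ∘ suc) (E′ f) f) ⟩
      ∑ (functions k N) (diagonal σ E) ∎
      where
      open Polynomials
      rest = blocksProduct N r (modes (σ ∘ suc))
      E′ : Vec (Fin N) k → Fin k → Vec (Fin N) r → Poly V
      E′ f j v = E j (lookup f (σ zero j) ∷ v)
      head : Vec (Fin N) k → Fin (k + k) → Power N r → Poly V
      head f i c = glued r E i (lookup f (modes σ zero i) , c)
      head-f : ∀ f i c → head f i c ≡ pinned r (E′ f) f i c
      head-f f i c with splitAt k i
      ... | inj₁ j = refl
      ... | inj₂ m = refl

  -- The hyperclique tensor

  module _ (h′ : ℕ) where

    private
      h k d : ℕ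
      h = suc h′
      k = suc h
      d = k + k

    complementary : Fin h → Fin k → Fin k
    complementary i j = punchIn j i

    edge : ∀ {N} → Fin k → Vec (Fin N) h → HVar h k N
    edge j v = omit j , Vec.cast (sym (proj₂ (omit j))) v

    gluing : ∀ {N} → Var {d} (λ _ → Power N h) → F.Carrier ⊎ HVar h k N
    gluing (i , (a , c)) =
      [ (λ j → inj₂ (edge j (a ∷ toVec h′ c))) , (λ m → inj₁ (agree a (toVec h′ c))) ]′
      (splitAt k i)

    -- In the term of f, the e_j-variable is indexed by f restricted to the complement of j, and
    -- these complements are all the h-element subsets of [k].
    ∑-diagonal : ∀ N →
      ∑ (functions k N) (diagonal complementary (λ j v → var (edge j v))) ≋ H h k N
    ∑-diagonal N = ∑.fold-cong (functions k N) λ f → begin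
      ∏ (allFin k) (λ j → var (edge j (tabulate λ i → lookup f (punchIn j i))))
        ≈⟨ (∏.fold-cong (allFin k) λ j →
             reflexive (cong (λ v → var (omit j , v)) (sym (restrict-omit j f)))) ⟩
      ∏ (allFin k) (λ j → var (omit j , restrict (proj₁ (omit j)) f))
        ≈⟨ ∏.fold-subsetsOfSize h _ ⟨
      ∏ (subsetsOfSize h k) (λ S → var (S , restrict (proj₁ S) f)) ∎
      where open Polynomials

    substitute-gluing : ∀ N →
      substitute gluing (poly (blocksProduct N h (modes complementary))) ≋ H h k N
    substitute-gluing N = begin
      substitute gluing (poly W)
        ≈⟨ reflexive (substitute-poly gluing W) ⟩
      evaluate (λ i c → leaf (gluing (i , c))) W
        ≈⟨ evaluate-cong (λ i c → leaf (gluing (i , c))) (glued h′ λ j v → var (edge j v))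
             (λ i c → reflexive (leaf-gluing i c)) W ⟩
      evaluate (glued h′ λ j v → var (edge j v)) W
        ≈⟨ evaluate-glued h′ complementary (λ j v → var (edge j v)) ⟩
      ∑ (functions k N) (diagonal complementary λ j v → var (edge j v))
        ≈⟨ ∑-diagonal N ⟩
      H h k N ∎
      where
      open Polynomials
      W = blocksProduct N h (modes complementary)
      leaf-gluing : ∀ i c → leaf (gluing (i , c)) ≡ glued h′ (λ j v → var (edge j v)) i c
      leaf-gluing i (a , c) with splitAt k i
      ... | inj₁ j = refl
      ... | inj₂ m = refl

    -- Complexity of the hyperclique tensor under submultiplicativity

    hypercliqueConstant : ℕ
    hypercliqueConstant = blocksConstant d k ^ h * (d * 2 + 4)

    C≤-H : Submultiplicative d → ∀ N → C[ H h k N ]≤ (hypercliqueConstant * N ^ h)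
    -- For N = 0 the modes would be empty, outside the scope of submultiplicativity. The sum then
    -- has no terms, so `H h k 0` is the constant 0 and takes no wires.
    C≤-H sub zero    = (1 , [] ▷ const F.0#) , (zero , ≋-refl) , z≤n
    C≤-H sub (suc n) = C≤-resp-≋ (substitute-gluing (suc n))
      (C≤-substitute gluing (C≤-blocksProduct sub n h (modes complementary)))

    submultiplicative⇒¬hyperclique : Submultiplicative d → ¬ HypercliqueConjecture h k
    submultiplicative⇒¬hyperclique sub conjecture = conjecture
      -- For ε = 1 numerator and denominator are 1, so the bound to show is s · N ≤ c · N^k; as k =
      -- h + 1, it follows from s ≤ c · N^h.
      (1ℚ , positive⁻¹ 1ℚ , (λ N → proj₁ (C≤-H sub N)) , (λ N → proj₁ (proj₂ (C≤-H sub N))) ,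
       hypercliqueConstant , 0 , λ N _ → bound N)
      where
      open ≤-Reasoning
      bound : ∀ N → size (proj₁ (C≤-H sub N)) ^ 1 * N ^ 1 ≤ hypercliqueConstant * N ^ (k * 1)
      bound N = begin
        size (proj₁ (C≤-H sub N)) ^ 1 * N ^ 1
          ≡⟨ cong₂ _*_ (*-identityʳ (size (proj₁ (C≤-H sub N)))) (*-identityʳ N) ⟩
        size (proj₁ (C≤-H sub N)) * N
          ≤⟨ *-monoˡ-≤ N (proj₂ (proj₂ (C≤-H sub N))) ⟩
        hypercliqueConstant * N ^ h * N
          ≡⟨ *-assoc hypercliqueConstant (N ^ h) N ⟩
        hypercliqueConstant * (N ^ h * N)
          ≡⟨ cong (hypercliqueConstant *_) (*-comm (N ^ h) N) ⟩
        hypercliqueConstant * N ^ k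
          ≡⟨ cong (λ e → hypercliqueConstant * N ^ e) (*-identityʳ k) ⟨
        hypercliqueConstant * N ^ (k * 1) ∎

theorem4 : ∀ {c ℓ₁ ℓ₂} (F : HeytingField c ℓ₁ ℓ₂) (d : ℕ) → 8 ≤ d → 2 ∣ d →
    Over.HypercliqueConjecture F (d / 2 ∸ 1) (d / 2) →
    ¬ Over.Submultiplicative F d
theorem4 F _ (s≤s (s≤s ())) (divides 1 refl)
-- Here k is at least 2, so h = k - 1 is positive and there is a first factor to glue the others to.
theorem4 F _ _ (divides (suc (suc h′)) refl) conjecture sub =
  submultiplicative⇒¬hyperclique F h′
    (subst (Over.Submultiplicative F) (n*2≡n+n k) sub)
    (subst (λ m → Over.HypercliqueConjecture F (m ∸ 1) m) (m*n/n≡m k 2) conjecture)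
  where
  k = suc (suc h′)
  n*2≡n+n : ∀ n → n * 2 ≡ n + n
  n*2≡n+n n = trans (*-comm n 2) (cong (n +_) (+-identityʳ n))
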